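{- For every even positive integer $n$, there are at most $2^{\left\lceil \frac{n}{24}\right\rceil}$ multi-symmetric Steinhaus matrices of size $n$ whose associated Steinhaus graphs are regular modulo $4$.
   Context: A Steinhaus matrix of size $n\geq1$ is a matrix $M=(a_{i,j})_{1\leq i,j\leq n}$ with entries in $\mathbb{F}_2=\{0,1\}$ such that $a_{i,i}=0$ for all $i$, $a_{i,j}=a_{i-1,j-1}+a_{i-1,j}$ (addition in $\mathbb{F}_2$) for all $2\leq i<j\leq n$, and $a_{i,j}=a_{j,i}$ for all $i,j$. The associated Steinhaus graph is the simple graph on vertices $V_1,\ldots,V_n$ with adjacency matrix $M$. A graph is regular modulo $4$ if all its vertex degrees are congruent modulo $4$. A square matrix $(a_{i,j})$ of size $n$ is doubly-symmetric if $a_{i,j}=a_{j,i}=a_{n-j+1,n-i+1}$ for all $i,j$; it is multi-symmetric if it is doubly-symmetric and $a_{i,j}=a_{i,n-j+i+1}$ for all $1\leq i<j\leq n$. -}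

module Defs where

open import Data.Nat using (ℕ; zero; suc; _+_; _<_; _∸_)
open import Data.Nat.DivMod using (_%_; _/_)
open import Data.Bool using (Bool; true; false; _xor_; if_then_else_)
open import Data.Fin using (Fin; toℕ)
open import Data.List using (map; allFin)
open import Data.Nat.ListAction using (sum)
open import Relation.Binary.PropositionalEquality using (_≡_)
open import Data.Product using (_×_)

-- Square matrices of size n over F₂ = Bool (false = 0, true = 1, xor = addition),
-- indexed 0-based by Fin n (paper index i corresponds to toℕ i + 1).
Matrix : ℕ → Set
Matrix n = Fin n → Fin n → Bool

IsSteinhaus : (n : ℕ) → Matrix n → Set
IsSteinhaus n M =
  (∀ i → M i i ≡ false) ×
  (∀ i j → M i j ≡ M j i) ×
  (∀ (i j i′ j′ : Fin n) → toℕ i ≡ suc (toℕ i′) → toℕ j ≡ suc (toℕ j′) →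
     toℕ i < toℕ j → M i j ≡ (M i′ j′ xor M i′ j))

-- Doubly-symmetric: a_{i,j} = a_{j,i} = a_{n-j+1,n-i+1} (1-based);
-- 0-based the entry (i,j) is matched with (n-1-j, n-1-i).
IsDoublySymmetric : (n : ℕ) → Matrix n → Set
IsDoublySymmetric n M =
  (∀ i j → M i j ≡ M j i) ×
  (∀ (i j i₂ j₂ : Fin n) → suc (toℕ i₂ + toℕ j) ≡ n → suc (toℕ j₂ + toℕ i) ≡ n →
     M i j ≡ M i₂ j₂)

-- Multi-symmetric: doubly-symmetric and a_{i,j} = a_{i,n-j+i+1} for 1 ≤ i < j ≤ n
-- (1-based); 0-based column k with k + j = n + i.
IsMultiSymmetric : (n : ℕ) → Matrix n → Set
IsMultiSymmetric n M =
  IsDoublySymmetric n M ×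
  (∀ (i j k : Fin n) → toℕ i < toℕ j → toℕ k + toℕ j ≡ n + toℕ i → M i j ≡ M i k)

degree : {n : ℕ} → Matrix n → Fin n → ℕ
degree {n} M i = sum (map (λ j → if M i j then 1 else 0) (allFin n))

RegularMod4 : {n : ℕ} → Matrix n → Set
RegularMod4 M = ∀ i j → degree M i % 4 ≡ degree M j % 4

ceil24 : ℕ → ℕ
ceil24 n = (n + 23) / 24

{-# OPTIONS --safe #-}
module Submission where

-- Write n = 2D + 2 and index the entry a(z+1, z+y+2) by (x, y, z) with x + y + z = 2D.  A multi-symmetric
-- Steinhaus matrix becomes an S₃-invariant φ with φ(x,y,z+1) = φ(x+1,y,z) + φ(x,y+1,z), a rule which also
-- holds with steps of 2.  Every row of the triangle is a palindrome and half rows telescope, so regularity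
-- modulo 4 is linear: φ(D,D,0) = 0 and φ(2v,1,2u+1) = φ(v+1,v,2u+1), i.e. the second line along each side
-- repeats, at alternate places, the entries next to the median.
--
-- Suppose now the entries next to the median vanish in the rows between ≈ n/4 and ≈ n/3 (about n/24 values).
-- By the rule and S₃-invariance φ vanishes where all coordinates are ≥ n/4, in particular next to the median
-- in rows n/4 … n/2.  Folding gives zeros along the second lines, and the rule with steps of 2 extends them
-- to all the entries next to the median that were missing in the rows 1 … n/4; the first argument then
-- applies again and gives φ = 0.  As the conditions are linear, these n/24 values determine the matrix.

open import Defs
open import Data.Bool using (Bool; true; false; not; _xor_; if_then_else_)
open import Data.Bool.Properties using (xor-assoc; xor-comm; xor-same; xor-identityʳ; not-involutive)
open import Data.Fin as Fin using (Fin; toℕ; fromℕ<; funToFin; finToFun)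
open import Data.Fin.Properties using (toℕ-fromℕ<; toℕ-injective; toℕ<n; pigeonhole; finToFun-funToFin)
open import Data.List using (tabulate)
open import Data.List.Properties using (map-tabulate)
open import Data.Nat using (ℕ; zero; suc; _+_; _*_; _∸_; _/_; _%_; _^_; _≤_; _<_; _≟_; _≤?_; z≤n; s≤s)
open import Data.Nat.DivMod using ([m+n]%n≡m%n; m≡m%n+[m/n]*n; m%n<n; m/n*n≤m)
open import Data.Nat.Divisibility using (_∣_; divides)
open import Data.Nat.ListAction using (sum)
open import Data.Nat.Properties
open import Data.Nat.Tactic.RingSolver using (solve-∀)
open import Data.Product using (_×_; _,_; proj₁; proj₂; ∃-syntax)
open import Data.Sum using (_⊎_; inj₁; inj₂)
open import Function using (_∘_; id)
open import Relation.Binary.Definitions using (tri<; tri≈; tri>)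
open import Relation.Binary.PropositionalEquality
open import Relation.Nullary using (¬_; yes; no; contradiction)
open import Relation.Nullary.Decidable using (decidable-stable)

-- Parity and addition in F₂.

odd : ℕ → Bool
odd zero    = false
odd (suc n) = not (odd n)

odd-+ : ∀ m n → odd (m + n) ≡ odd m xor odd n
odd-+ zero    n = refl
odd-+ (suc m) n = trans (cong not (odd-+ m n)) (lem (odd m) (odd n))
  where
  lem : ∀ a b → not (a xor b) ≡ not a xor b
  lem true  b = not-involutive b
  lem false b = refl

odd-*2 : ∀ n → odd (n * 2) ≡ false
odd-*2 zero    = refl
odd-*2 (suc n) = trans (not-involutive _) (odd-*2 n)

*2≡+ : ∀ n → n * 2 ≡ n + n
*2≡+ = solve-∀

halve : ∀ n → ∃[ k ] (n ≡ k * 2 ⊎ n ≡ suc (k * 2))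
halve zero = 0 , inj₁ refl
halve (suc n) with halve n
... | k , inj₁ p = k , inj₂ (cong suc p)
... | k , inj₂ p = suc k , inj₁ (cong suc p)

-- The left side is odd. Hence next to the median only the odd rows meet the plane, and
-- `φ (suc k) k (suc e)` matters for even `e` alone.
1+k+k+even≢even : ∀ k w n → suc k + k + (2 + w * 2) ≢ n * 2
1+k+k+even≢even k w n p = contradiction
  (trans (sym (cong not (odd-*2 (suc (k + w))))) (trans (cong odd (trans (sym (eq k w)) p)) (odd-*2 n))) λ ()
  where
  eq : ∀ k w → suc k + k + (2 + w * 2) ≡ suc (suc (k + w) * 2)
  eq = solve-∀

xor-≡false⇒≡ : ∀ a b → a xor b ≡ false → a ≡ b
xor-≡false⇒≡ false b p = sym p
xor-≡false⇒≡ true  true p = refl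

xor-cancel-mid : ∀ a b c → (a xor b) xor (b xor c) ≡ a xor c
xor-cancel-mid false b c = trans (sym (xor-assoc b b c)) (cong (_xor c) (xor-same b))
xor-cancel-mid true false c = refl
xor-cancel-mid true true c = refl

-- Symmetric triangles and propagation of zeros.

-- φ is totalised by false off the plane x + y + z = 2D, which makes the laws unconditional.
record Symmetric (D : ℕ) (φ : ℕ → ℕ → ℕ → Bool) : Set where
  field
    off  : ∀ x y z → x + y + z ≢ D * 2 → φ x y z ≡ false
    rule : ∀ x y z → φ x y (suc z) ≡ φ (suc x) y z xor φ x (suc y) z
    swap₁₂ : ∀ x y z → φ x y z ≡ φ y x z
    swap₁₃ : ∀ x y z → φ x y z ≡ φ z y x

record Regular (D : ℕ) (φ : ℕ → ℕ → ℕ → Bool) : Set where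
  field
    symmetric : Symmetric D φ
    middle : 0 < D → φ D D 0 ≡ false
    fold   : ∀ u v → φ (v * 2) 1 (suc (u * 2)) ≡ φ (suc v) v (suc (u * 2))
  open Symmetric symmetric public

module Vanishing {D φ} (S : Symmetric D φ) where
  open Symmetric S

  Z : ℕ → ℕ → ℕ → Set
  Z x y z = φ x y z ≡ false

  Z₁₂ : ∀ x y z → Z x y z → Z y x z
  Z₁₂ x y z = trans (swap₁₂ y x z)

  Z₁₃ : ∀ x y z → Z x y z → Z z y x
  Z₁₃ x y z = trans (swap₁₃ z y x)

  Z₂₃ : ∀ x y z → Z x y z → Z x z y
  Z₂₃ x y z p = Z₁₂ z x y (Z₁₃ y x z (Z₁₂ x y z p))

  -- Two applications of `rule` produce `φ (suc x) (suc y) z` twice, and these terms cancel in F₂ as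
  -- in the square of a sum.
  rule² : ∀ x y z → φ x y (2 + z) ≡ φ (2 + x) y z xor φ x (2 + y) z
  rule² x y z = trans (rule x y (suc z))
    (trans (cong₂ _xor_ (rule (suc x) y z) (rule x (suc y) z))
      (xor-cancel-mid (φ (2 + x) y z) (φ (suc x) (suc y) z) (φ x (2 + y) z)))

  rule₀ : ∀ x y z → Z (suc x) y z → Z x (suc y) z → Z x y (suc z)
  rule₀ x y z p q = trans (rule x y z) (cong₂ _xor_ p q)

  -- The rule says that three entries sum to zero, and permuting coordinates preserves this
  -- relation; so any two zeros force the third.
  rule₁ : ∀ x y z → Z x (suc y) z → Z x y (suc z) → Z (suc x) y z
  rule₁ x y z p q = Z₁₃ z y (suc x) (rule₀ z y x (Z₁₃ x y (suc z) q) (Z₁₃ x (suc y) z p))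

  rule²₀ : ∀ x y z → Z (2 + x) y z → Z x (2 + y) z → Z x y (2 + z)
  rule²₀ x y z p q = trans (rule² x y z) (cong₂ _xor_ p q)

  rule²₂ : ∀ x y z → Z (2 + x) y z → Z x y (2 + z) → Z x (2 + y) z
  rule²₂ x y z p q = Z₂₃ x z (2 + y) (rule²₀ x z y (Z₂₃ (2 + x) y z p) (Z₂₃ x y (2 + z) q))

  -- On the median the two terms of the rule are mirror images.
  centre : ∀ k e → Z k k (suc e)
  centre k e = trans (rule k k e) (trans (cong (φ (suc k) k e xor_) (swap₁₂ k (suc k) e)) (xor-same (φ (suc k) k e)))

  corner : ∀ z → Z 0 0 (suc z)
  corner z = trans (rule 0 0 z) (trans (cong (φ 1 0 z xor_) (swap₁₂ 0 1 z)) (xor-same (φ 1 0 z)))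

  -- Moving sideways from the median costs one row per half step, so a zero stretch of it
  -- controls the triangle hanging from its top row.
  spread : ∀ {e₀ K} → (∀ e k → e₀ ≤ e → K ≤ k → Z (suc k) k (suc e)) →
           ∀ m b e → e₀ ≤ e → K ≤ b → Z (m + b) b (suc e)
  spread h zero          b e p q = centre b e
  spread h (suc zero)    b e p q = h e b p q
  spread h (suc (suc m)) b e p q = rule₁ (suc m + b) b (suc e)
    (subst (λ t → Z t (suc b) (suc e)) (+-suc m b) (spread h m (suc b) e p (m≤n⇒m≤1+n q)))
    (spread h (suc m) b (suc e) (m≤n⇒m≤1+n p) q)

  spread′ : ∀ {e₀ K} → (∀ e k → e₀ ≤ e → K ≤ k → Z (suc k) k (suc e)) →
            ∀ a b e → e₀ ≤ e → K ≤ a → K ≤ b → Z a b (suc e)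
  spread′ h a b e p q r with ≤-total a b
  ... | inj₁ a≤b = Z₁₂ b a (suc e) (subst (λ t → Z t a (suc e)) (m∸n+n≡m a≤b) (spread h (b ∸ a) a e p q))
  ... | inj₂ b≤a = subst (λ t → Z t b (suc e)) (m∸n+n≡m b≤a) (spread h (a ∸ b) b e p r)

  -- By 3K ≤ 2D + 2 the triangles spread from the three medians meet at the centroid,
  -- so the wedges between them can be filled row by row.
  module _ {e₀ K} (h : ∀ e k → e₀ ≤ e → K ≤ k → Z (suc k) k (suc e)) (3K≤ : K * 3 ≤ 2 + D * 2) where

    below-wedge : ∀ a b → suc a < K → suc b < K → a ≢ b → suc (suc a + suc b + 2) ≤ K + K
    below-wedge a b a<K b<K a≢b with ≤-total a b
    ... | inj₁ a≤b = ≤-trans (≤-reflexive (eq a b)) (+-mono-≤ (≤-trans (+-monoʳ-≤ 2 (≤∧≢⇒< a≤b a≢b)) b<K) b<K)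
      where
      eq : ∀ a b → suc (suc a + suc b + 2) ≡ 2 + suc a + (2 + b)
      eq = solve-∀
    ... | inj₂ b≤a = ≤-trans (≤-reflexive (eq a b)) (+-mono-≤ a<K (≤-trans (+-monoʳ-≤ 2 (≤∧≢⇒< b≤a (≢-sym a≢b))) a<K))
      where
      eq : ∀ a b → suc (suc a + suc b + 2) ≡ 2 + a + (2 + suc b)
      eq = solve-∀

    -- Distinct coordinates below `K` sum to at most 2K - 3, while 2D ≥ 3K - 2. The strict bound
    -- lets `wedge` lower `c` by one and still have `K ≤ c`.
    above : ∀ a b c → suc a < K → suc b < K → a ≢ b → suc a + suc b + c ≡ D * 2 → K < c
    above a b c a<K b<K a≢b s≡ = +-cancelˡ-≤ (suc a + suc b + 2) (suc K) c (begin
      suc a + suc b + 2 + suc K         ≡⟨ eq₁ (suc a + suc b + 2) K ⟩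
      suc (suc a + suc b + 2) + K       ≤⟨ +-monoˡ-≤ K (below-wedge a b a<K b<K a≢b) ⟩
      K + K + K                         ≡⟨ eq₂ K ⟩
      K * 3                             ≤⟨ 3K≤ ⟩
      2 + D * 2                         ≡⟨ cong (2 +_) s≡ ⟨
      2 + (suc a + suc b + c)           ≡⟨ eq₃ (suc a + suc b) c ⟩
      suc a + suc b + 2 + c             ∎)
      where
      open ≤-Reasoning
      eq₁ : ∀ s k → s + suc k ≡ suc s + k
      eq₁ = solve-∀
      eq₂ : ∀ k → k + k + k ≡ k * 3
      eq₂ = solve-∀
      eq₃ : ∀ s c → 2 + (s + c) ≡ s + 2 + c
      eq₃ = solve-∀

    -- Once `suc a` or `suc b` reaches `K`, the triangle spread from another median contains the
    -- point. Until then the rule trades `c` for one of them.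
    wedge : ∀ c a b → K ≤ c → e₀ ≤ a → e₀ ≤ b → Z (suc a) (suc b) c
    wedge c a b K≤c e≤a e≤b with K ≤? suc a
    ... | yes K≤a = Z₂₃ (suc a) c (suc b) (spread′ h (suc a) c b e≤b K≤a K≤c)
    wedge zero a b K≤c e≤a e≤b | no K≰a = contradiction (≤-trans K≤c z≤n) K≰a
    wedge (suc c) a b K≤c e≤a e≤b | no K≰a with K ≤? suc b
    ... | yes K≤b = Z₁₃ (suc c) (suc b) (suc a) (spread′ h (suc c) (suc b) a e≤a K≤c K≤b)
    ... | no K≰b with a ≟ b | suc a + suc b + suc c ≟ D * 2
    -- For equal coordinates the bound of `above` can fail by one, but the point lies on the median.
    ...   | yes refl | _      = centre (suc a) c
    ...   | no _     | no s≢  = off (suc a) (suc b) (suc c) s≢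
    ...   | no a≢b   | yes s≡ = rule₀ (suc a) (suc b) c
      (wedge c (suc a) b K≤c′ (m≤n⇒m≤1+n e≤a) e≤b) (wedge c a (suc b) K≤c′ e≤a (m≤n⇒m≤1+n e≤b))
      where
      K≤c′ : K ≤ c
      K≤c′ = ≤-pred (above a b (suc c) (≰⇒> K≰a) (≰⇒> K≰b) a≢b s≡)

    -- Three coordinates below `K` sum to at most 3K - 3 < 2D, so on the plane some coordinate is at
    -- least `K`; `wedge` applies once it is moved to the last place.
    fill : ∀ a b c → e₀ ≤ a → e₀ ≤ b → e₀ ≤ c → Z (suc a) (suc b) (suc c)
    fill a b c e≤a e≤b e≤c with K ≤? suc a | K ≤? suc b | K ≤? suc c
    ... | yes K≤a | _ | _ = Z₁₃ (suc c) (suc b) (suc a) (wedge (suc a) c b K≤a e≤c e≤b)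
    ... | no _ | yes K≤b | _ = Z₂₃ (suc a) (suc c) (suc b) (wedge (suc b) a c K≤b e≤a e≤c)
    ... | no _ | no _ | yes K≤c = wedge (suc c) a b K≤c e≤a e≤b
    ... | no K≰a | no K≰b | no K≰c = off (suc a) (suc b) (suc c) λ s≡ →
      <⇒≱ {2 + D * 2} {K * 3} (begin-strict
        2 + D * 2                      ≡⟨ cong (2 +_) s≡ ⟨
        2 + (suc a + suc b + suc c)    <⟨ n<1+n _ ⟩
        3 + (suc a + suc b + suc c)    ≡⟨ eq a b c ⟩
        2 + a + (2 + b) + (2 + c)      ≤⟨ +-mono-≤ (+-mono-≤ (≰⇒> K≰a) (≰⇒> K≰b)) (≰⇒> K≰c) ⟩
        K + K + K                      ≡⟨ eq₂ K ⟩
        K * 3                          ∎) 3K≤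
      where
      open ≤-Reasoning
      eq : ∀ a b c → 3 + (suc a + suc b + suc c) ≡ 2 + a + (2 + b) + (2 + c)
      eq = solve-∀
      eq₂ : ∀ k → k + k + k ≡ k * 3
      eq₂ = solve-∀

-- Zeros forced by regularity.

module RegularVanishing {D φ} (R : Regular D φ) where
  open Regular R
  open Vanishing symmetric

  module Inner {f} (1+4f≤D : 1 + f * 4 ≤ D)
               (inner : ∀ a b c → f * 2 ≤ a → f * 2 ≤ b → f * 2 ≤ c → Z (suc a) (suc b) (suc c)) where

    -- For `w = 0` the fold leads into the region covered by `inner`. The rule with steps of 2 then
    -- raises `w` using only larger `v` or `u`, so the bounds on these persist.
    column : ∀ w v u → suc (f * 2) ≤ v → f ≤ u → Z (v * 2) (suc (w * 2)) (suc (u * 2))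
    column zero (suc v) u (s≤s 2f≤v) f≤u =
      trans (fold u (suc v)) (Z₁₂ (suc v) (2 + v) (suc (u * 2))
        (inner v (suc v) (u * 2) 2f≤v (m≤n⇒m≤1+n 2f≤v) (*-monoˡ-≤ 2 f≤u)))
    column (suc w) v u 2f<v f≤u = rule²₂ (v * 2) (suc (w * 2)) (suc (u * 2))
      (column w (suc v) u (m≤n⇒m≤1+n 2f<v) f≤u) (column w v (suc u) 2f<v (m≤n⇒m≤1+n f≤u))

    -- Halving the plane equation gives u + v + w + 1 = D ≥ 1 + 4f, and v + w + 1 is at most 3f.
    large : ∀ u v w → w < f → v ≤ f * 2 → v * 2 + suc (w * 2) + suc (u * 2) ≡ D * 2 → f < u
    large u v w w<f v≤2f s≡ = +-cancelˡ-≤ (f + f * 2) (suc f) u (begin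
      f + f * 2 + suc f     ≡⟨ eq₁ f ⟩
      1 + f * 4             ≤⟨ 1+4f≤D ⟩
      D                     ≡⟨ *-cancelʳ-≡ D (suc w + v + u) 2 (trans (sym s≡) (eq₂ u v w)) ⟩
      suc w + v + u         ≤⟨ +-monoˡ-≤ u (+-mono-≤ w<f v≤2f) ⟩
      f + f * 2 + u         ∎)
      where
      open ≤-Reasoning
      eq₁ : ∀ f → f + f * 2 + suc f ≡ 1 + f * 4
      eq₁ = solve-∀
      eq₂ : ∀ u v w → v * 2 + suc (w * 2) + suc (u * 2) ≡ (suc w + v + u) * 2
      eq₂ = solve-∀

    -- Induction on `u`: the rule with steps of 2 trades `u` for `v` or `w` until `w` reaches `f`,
    -- where `inner` applies, or `v` exceeds 2f, where `column` applies.
    side : ∀ u v w → f ≤ u → f < v → Z (v * 2) (suc (w * 2)) (suc (u * 2))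
    side u (suc v) w f≤u (s≤s f≤v) with f ≤? w
    ... | yes f≤w = inner (suc (v * 2)) (w * 2) (u * 2)
      (m≤n⇒m≤1+n (*-monoˡ-≤ 2 f≤v)) (*-monoˡ-≤ 2 f≤w) (*-monoˡ-≤ 2 f≤u)
    side u (suc v) w f≤u (s≤s f≤v) | no f≰w with suc (f * 2) ≤? suc v
    ... | yes 2f<v = column w (suc v) u 2f<v f≤u
    ... | no 2f≮v with suc v * 2 + suc (w * 2) + suc (u * 2) ≟ D * 2
    ...   | no s≢ = off (suc v * 2) (suc (w * 2)) (suc (u * 2)) s≢
    side zero (suc v) w f≤u (s≤s f≤v) | no f≰w | no 2f≮v | yes s≡ =
      contradiction (large zero (suc v) w (≰⇒> f≰w) (≮⇒≥ 2f≮v) s≡) λ ()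
    side (suc u) (suc v) w f≤u (s≤s f≤v) | no f≰w | no 2f≮v | yes s≡ =
      rule²₀ (suc v * 2) (suc (w * 2)) (suc (u * 2))
        (side u (2 + v) w f≤u′ (s≤s (m≤n⇒m≤1+n f≤v))) (side u (suc v) (suc w) f≤u′ (s≤s f≤v))
      where
      f≤u′ : f ≤ u
      f≤u′ = ≤-pred (large (suc u) (suc v) w (≰⇒> f≰w) (≮⇒≥ 2f≮v) s≡)

    -- On the plane the row number is odd, and `k` and `suc k` have opposite parities: this is the
    -- pattern of `side`, which bounds `w` nowhere and so reaches the rows below 2f.
    median : ∀ e k → 0 ≤ e → suc (f * 2) ≤ k → Z (suc k) k (suc e)
    median e k _ 2f<k with halve e
    ... | w , inj₂ refl = off (suc k) k (2 + w * 2) (1+k+k+even≢even k w D)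
    ... | w , inj₁ refl with halve k
    ...   | v , inj₁ refl = Z₁₂ (v * 2) (suc (v * 2)) (suc (w * 2)) (Z₂₃ (v * 2) (suc (w * 2)) (suc (v * 2))
      (side v v w (<⇒≤ f<v) f<v))
      where
      f<v : f < v
      f<v = *-cancelʳ-< 2 f v 2f<k
    ...   | u , inj₂ refl = Z₂₃ (suc u * 2) (suc (w * 2)) (suc (u * 2)) (side u (suc u) w f≤u (s≤s f≤u))
      where
      f≤u : f ≤ u
      f≤u = *-cancelʳ-≤ f u 2 (≤-pred 2f<k)

  -- Zeros in row 1 make neighbours in row 0 equal, so row 0 is constant apart from its corners;
  -- `everywhere` compares it with `middle`.
  edge : (∀ a b c → Z (suc a) (suc b) (suc c)) → ∀ y x → φ (suc x) (suc y) 0 ≡ φ (suc (y + x)) 1 0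
  edge interior zero    x = refl
  edge interior (suc y) x = trans
    (sym (xor-≡false⇒≡ _ _ (trans (sym (rule (suc x) (suc y) 0)) (interior x y 0))))
    (trans (edge interior y (suc x)) (cong (λ t → φ (suc t) 1 0) (+-suc y x)))

  everywhere : 0 < D → (∀ a b c → Z (suc a) (suc b) (suc c)) → ∀ a b c → Z a b c
  everywhere (s≤s {n = D′} _) interior = go
    where
    edge-zero : ∀ x y → Z (suc x) (suc y) 0
    edge-zero x y with suc x + suc y + 0 ≟ D * 2
    ... | no s≢ = off (suc x) (suc y) 0 s≢
    ... | yes s≡ = trans (edge interior y x) (trans (cong (λ t → φ (suc t) 1 0) y+x≡)
                     (trans (sym (edge interior D′ D′)) (middle (s≤s z≤n))))
      where
      eq : ∀ x y → suc x + suc y + 0 ≡ 2 + (y + x)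
      eq = solve-∀
      y+x≡ : y + x ≡ D′ + D′
      y+x≡ = trans (suc-injective (suc-injective (trans (sym (eq x y)) s≡))) (*2≡+ D′)

    go : ∀ a b c → Z a b c
    go zero    zero    zero    = off 0 0 0 λ ()
    go zero    zero    (suc c) = corner c
    go zero    (suc b) zero    = Z₂₃ 0 0 (suc b) (corner b)
    go (suc a) zero    zero    = Z₁₃ 0 0 (suc a) (corner a)
    go zero    (suc b) (suc c) = Z₁₃ (suc c) (suc b) 0 (edge-zero c b)
    go (suc a) zero    (suc c) = Z₂₃ (suc a) (suc c) 0 (edge-zero a c)
    go (suc a) (suc b) zero    = edge-zero a b
    go (suc a) (suc b) (suc c) = interior a b c

  -- Two rounds of `fill`: the first supplies `Inner`, whose `median` starts at row 1, so the second
  -- reaches every point with positive coordinates.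
  vanishing : ∀ {f K} → 1 + f * 4 ≤ D → K * 3 ≤ 2 + D * 2 →
              (∀ e k → f * 2 ≤ e → K ≤ k → Z (suc k) k (suc e)) → ∀ a b c → Z a b c
  vanishing {f} {K} 1+4f≤D 3K≤ h = everywhere (≤-trans (s≤s z≤n) 1+4f≤D) λ a b c →
    fill median (begin
      suc (f * 2) * 3          ≤⟨ m≤m+n (suc (f * 2) * 3) (1 + f * 2) ⟩
      suc (f * 2) * 3 + (1 + f * 2) ≡⟨ eq f ⟩
      2 + (1 + f * 4) * 2      ≤⟨ +-monoʳ-≤ 2 (*-monoˡ-≤ 2 1+4f≤D) ⟩
      2 + D * 2                ∎) a b c z≤n z≤n z≤n
    where
    open Inner {f} 1+4f≤D (fill h 3K≤)
    open ≤-Reasoning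
    eq : ∀ f → suc (f * 2) * 3 + (1 + f * 2) ≡ 2 + (1 + f * 4) * 2
    eq = solve-∀

-- Counting along antidiagonals.

bit : Bool → ℕ
bit b = if b then 1 else 0

odd-bit : ∀ b → odd (bit b) ≡ b
odd-bit true  = refl
odd-bit false = refl

-- Here `l` is the number of entries, so x + y = l - 1. With both coordinates kept, reversing a row
-- is exchanging arguments.
antidiag : (ℕ → ℕ → Bool) → ℕ → ℕ
antidiag g zero    = 0
antidiag g (suc l) = bit (g l 0) + antidiag (λ x y → g x (suc y)) l

antidiag-cong : ∀ l {g h : ℕ → ℕ → Bool} → (∀ x y → suc (x + y) ≡ l → g x y ≡ h x y) → antidiag g l ≡ antidiag h l
antidiag-cong zero    p = refl
antidiag-cong (suc l) p = cong₂ _+_ (cong bit (p l 0 (cong suc (+-identityʳ l))))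
  (antidiag-cong l λ x y q → p x (suc y) (cong suc (trans (+-suc x y) q)))

antidiag-split : ∀ k l (g : ℕ → ℕ → Bool) →
             antidiag g (k + l) ≡ antidiag (λ x y → g (l + x) y) k + antidiag (λ x y → g x (k + y)) l
antidiag-split zero    l g = refl
antidiag-split (suc k) l g = trans
  (cong₂ _+_ (cong (λ t → bit (g t 0)) (+-comm k l)) (antidiag-split k l (λ x y → g x (suc y))))
  (sym (+-assoc (bit (g (l + k) 0)) _ _))

antidiag-last : ∀ l (g : ℕ → ℕ → Bool) → antidiag g (suc l) ≡ antidiag (λ x y → g (suc x) y) l + bit (g 0 l)
antidiag-last l g = trans (cong (antidiag g) (+-comm 1 l)) (trans (antidiag-split l 1 g)
  (cong (antidiag (λ x y → g (suc x) y) l +_)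
    (trans (+-identityʳ _) (cong (λ t → bit (g 0 t)) (+-identityʳ l)))))

antidiag-flip : ∀ l (g : ℕ → ℕ → Bool) → antidiag g l ≡ antidiag (λ x y → g y x) l
antidiag-flip zero    g = refl
antidiag-flip (suc l) g = trans (cong (bit (g l 0) +_) (antidiag-flip l (λ x y → g x (suc y))))
  (trans (+-comm (bit (g l 0)) _) (sym (antidiag-last l (λ x y → g y x))))

antidiag-sym-even : ∀ k (g : ℕ → ℕ → Bool) → (∀ x y → g x y ≡ g y x) →
                antidiag g (k + k) ≡ antidiag (λ x y → g (k + x) y) k * 2
antidiag-sym-even k g s = trans (antidiag-split k k g) (trans
  (cong (antidiag (λ x y → g (k + x) y) k +_)
    (trans (antidiag-flip k (λ x y → g x (k + y))) (antidiag-cong k λ x y _ → s y (k + x))))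
  (sym (*2≡+ (antidiag (λ x y → g (k + x) y) k))))

antidiag-sym-odd : ∀ k (g : ℕ → ℕ → Bool) → (∀ x y → g x y ≡ g y x) →
               antidiag g (suc (k + k)) ≡ bit (g k k) + antidiag (λ x y → g (suc k + x) y) k * 2
antidiag-sym-odd k g s = trans (cong (antidiag g) (sym (+-suc k k))) (trans (antidiag-split k (suc k) g) (trans
  (cong (A +_) (cong₂ _+_ (cong (λ t → bit (g k t)) (+-identityʳ k))
    (trans (antidiag-flip k (λ x y → g x (k + suc y)))
      (antidiag-cong k λ x y _ → trans (s y (k + suc x)) (cong (λ t → g t y) (+-suc k x))))))
  (eq A (bit (g k k)))))
  where
  A = antidiag (λ x y → g (suc k + x) y) k
  eq : ∀ a b → a + (b + a) ≡ b + a * 2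
  eq = solve-∀

odd-antidiag-telescope : ∀ l (g h : ℕ → ℕ → Bool) → (∀ x y → g x y ≡ h (suc x) y xor h x (suc y)) →
                     odd (antidiag g l) ≡ h l 0 xor h 0 l
odd-antidiag-telescope zero    g h p = sym (xor-same (h 0 0))
odd-antidiag-telescope (suc l) g h p = trans (odd-+ (bit (g l 0)) _) (trans
  (cong₂ _xor_ (trans (odd-bit (g l 0)) (p l 0))
    (odd-antidiag-telescope l (λ x y → g x (suc y)) (λ x y → h x (suc y)) (λ x y → p x (suc y))))
  (xor-cancel-mid (h (suc l) 0) (h l 1) (h 0 (suc l))))

sum-tabulate : ∀ l (f : ℕ → Bool) (g : Fin l → ℕ) → (∀ j → g j ≡ bit (f (toℕ j))) →
               sum (tabulate g) ≡ antidiag (λ _ y → f y) l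
sum-tabulate zero    f g p = refl
sum-tabulate (suc l) f g p =
  cong₂ _+_ (p Fin.zero) (sum-tabulate l (f ∘ suc) (g ∘ Fin.suc) (p ∘ Fin.suc))

-- Triangle coordinates of a multi-symmetric Steinhaus matrix.

position : ∀ D x y z → x + y + z ≡ D * 2 →
           ∃[ i ] ∃[ j ] toℕ {suc D * 2} i ≡ z × toℕ {suc D * 2} j ≡ suc (z + y)
position D x y z s≡ = fromℕ< z< , fromℕ< zy< , toℕ-fromℕ< z< , toℕ-fromℕ< zy<
  where
  eq : ∀ x y z → x + (z + y) ≡ x + y + z
  eq = solve-∀
  zy< : suc (z + y) < suc D * 2
  zy< = s≤s (s≤s (≤-trans (m≤n+m (z + y) x) (≤-reflexive (trans (eq x y z) s≡))))
  z< : z < suc D * 2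
  z< = <-trans (s≤s (m≤m+n z y)) zy<

abstract
  tri : ∀ D → Matrix (suc D * 2) → ℕ → ℕ → ℕ → Bool
  tri D M x y z with x + y + z ≟ D * 2
  ... | no  _  = false
  ... | yes s≡ = M (proj₁ (position D x y z s≡)) (proj₁ (proj₂ (position D x y z s≡)))

  tri-off : ∀ D (M : Matrix (suc D * 2)) x y z → x + y + z ≢ D * 2 → tri D M x y z ≡ false
  tri-off D M x y z s≢ with x + y + z ≟ D * 2
  ... | no  _  = refl
  ... | yes s≡ = contradiction s≡ s≢

  tri-entry : ∀ D (M : Matrix (suc D * 2)) {x y z i j} →
              x + y + z ≡ D * 2 → toℕ i ≡ z → toℕ j ≡ suc (z + y) → tri D M x y z ≡ M i j
  tri-entry D M {x} {y} {z} {i} {j} s≡ p q with x + y + z ≟ D * 2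
  ... | no  s≢ = contradiction s≡ s≢
  ... | yes s≡ = let (_ , _ , p′ , q′) = position D x y z s≡ in
    cong₂ M (toℕ-injective (trans p′ (sym p))) (toℕ-injective (trans q′ (sym q)))

module _ D {M : Matrix (suc D * 2)}
         (steinhaus : IsSteinhaus (suc D * 2) M) (multi : IsMultiSymmetric (suc D * 2) M) where

  private φ = tri D M

  tri-rule : ∀ x y z → φ x y (suc z) ≡ φ (suc x) y z xor φ x (suc y) z
  tri-rule x y z with x + y + suc z ≟ D * 2
  ... | no s≢ = trans (tri-off D M x y (suc z) s≢) (sym (cong₂ _xor_
    (tri-off D M (suc x) y z (s≢ ∘ trans (eq₁ x y z))) (tri-off D M x (suc y) z (s≢ ∘ trans (eq₂ x y z)))))
    where
    eq₁ : ∀ x y z → x + y + suc z ≡ suc x + y + z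
    eq₁ = solve-∀
    eq₂ : ∀ x y z → x + y + suc z ≡ x + suc y + z
    eq₂ = solve-∀
  ... | yes s≡ with position D x y (suc z) s≡ | position D (suc x) y z (trans (eq₁ x y z) s≡)
    where
    eq₁ : ∀ x y z → suc x + y + z ≡ x + y + suc z
    eq₁ = solve-∀
  ...   | i , j , i≡ , j≡ | i′ , j′ , i′≡ , j′≡ =
    trans (tri-entry D M s≡ i≡ j≡) (trans
      (proj₂ (proj₂ steinhaus) i j i′ j′ (trans i≡ (cong suc (sym i′≡))) (trans j≡ (cong suc (sym j′≡)))
        (≤-trans (≤-reflexive (cong suc i≡)) (≤-trans (s≤s (s≤s (m≤m+n z y))) (≤-reflexive (sym j≡)))))
      (cong₂ _xor_ (sym (tri-entry D M (trans (eq₁ x y z) s≡) i′≡ j′≡))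
        (sym (tri-entry D M (trans (eq₂ x y z) s≡) i′≡ (trans j≡ (cong suc (sym (+-suc z y))))))))
    where
    eq₁ : ∀ x y z → suc x + y + z ≡ x + y + suc z
    eq₁ = solve-∀
    eq₂ : ∀ x y z → x + suc y + z ≡ x + y + suc z
    eq₂ = solve-∀

  -- In 0-based indices j = z + y + 1, so the double symmetry leads to row n - 1 - j = x.
  tri-swap₁₃ : ∀ x y z → φ x y z ≡ φ z y x
  tri-swap₁₃ x y z with x + y + z ≟ D * 2
  ... | no s≢ = trans (tri-off D M x y z s≢) (sym (tri-off D M z y x (s≢ ∘ trans (eq x y z))))
    where
    eq : ∀ x y z → x + y + z ≡ z + y + x
    eq = solve-∀
  ... | yes s≡ with position D x y z s≡ | position D z y x (trans (eq z y x) s≡)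
    where
    eq : ∀ x y z → x + y + z ≡ z + y + x
    eq = solve-∀
  ...   | i , j , i≡ , j≡ | i′ , j′ , i′≡ , j′≡ =
    trans (tri-entry D M s≡ i≡ j≡) (trans
      (proj₂ (proj₁ multi) i j i′ j′
        (trans (cong suc (cong₂ _+_ i′≡ j≡)) (trans (eq₁ x y z) (cong (2 +_) s≡)))
        (trans (cong suc (cong₂ _+_ j′≡ i≡)) (trans (eq₂ x y z) (cong (2 +_) s≡))))
      (sym (tri-entry D M (trans (eq z y x) s≡) i′≡ j′≡)))
    where
    eq : ∀ x y z → x + y + z ≡ z + y + x
    eq = solve-∀
    eq₁ : ∀ x y z → suc (x + suc (z + y)) ≡ 2 + (x + y + z)
    eq₁ = solve-∀
    eq₂ : ∀ x y z → suc (suc (x + y) + z) ≡ 2 + (x + y + z)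
    eq₂ = solve-∀

  -- The reflected column is n + i - j = z + x + 1.
  tri-swap₁₂ : ∀ x y z → φ x y z ≡ φ y x z
  tri-swap₁₂ x y z with x + y + z ≟ D * 2
  ... | no s≢ = trans (tri-off D M x y z s≢) (sym (tri-off D M y x z (s≢ ∘ trans (eq x y z))))
    where
    eq : ∀ x y z → x + y + z ≡ y + x + z
    eq = solve-∀
  ... | yes s≡ with position D x y z s≡ | position D y x z (trans (eq y x z) s≡)
    where
    eq : ∀ x y z → x + y + z ≡ y + x + z
    eq = solve-∀
  ...   | i , j , i≡ , j≡ | _ , k , _ , k≡ =
    trans (tri-entry D M s≡ i≡ j≡) (trans
      (proj₂ multi i j k (≤-trans (s≤s (≤-trans (≤-reflexive i≡) (m≤m+n z y))) (≤-reflexive (sym j≡)))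
        (trans (cong₂ _+_ k≡ j≡) (trans (eq₁ x y z) (cong₂ (λ s t → 2 + s + t) s≡ (sym i≡)))))
      (sym (tri-entry D M (trans (eq y x z) s≡) i≡ k≡)))
    where
    eq : ∀ x y z → x + y + z ≡ y + x + z
    eq = solve-∀
    eq₁ : ∀ x y z → suc (z + x) + suc (z + y) ≡ 2 + (x + y + z) + z
    eq₁ = solve-∀

  tri-symmetric : Symmetric D φ
  tri-symmetric = record { off = tri-off D M ; rule = tri-rule ; swap₁₂ = tri-swap₁₂ ; swap₁₃ = tri-swap₁₃ }

-- Vertex degrees modulo 4.

extend : ∀ {n} → (Fin n → Bool) → ℕ → Bool
extend {zero}  g t       = false
extend {suc n} g zero    = g Fin.zero
extend {suc n} g (suc t) = extend (g ∘ Fin.suc) t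

extend-toℕ : ∀ {n} (g : Fin n → Bool) j {t} → toℕ j ≡ t → extend g t ≡ g j
extend-toℕ g Fin.zero    refl = refl
extend-toℕ g (Fin.suc j) refl = extend-toℕ (g ∘ Fin.suc) j refl

double%4 : ∀ a → (a * 2) % 4 ≡ (if odd a then 2 else 0)
double%4 zero          = refl
double%4 (suc zero)    = refl
double%4 (suc (suc a)) = trans (cong (_% 4) (+-comm 4 (a * 2))) (trans ([m+n]%n≡m%n (a * 2) 4)
  (trans (double%4 a) (cong (if_then 2 else 0) (sym (not-involutive (odd a))))))

1+double%4 : ∀ a → suc (a * 2) % 4 ≡ (if odd a then 3 else 1)
1+double%4 zero          = refl
1+double%4 (suc zero)    = refl
1+double%4 (suc (suc a)) = trans (cong (_% 4) (+-comm 4 (suc (a * 2)))) (trans ([m+n]%n≡m%n (suc (a * 2)) 4)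
  (trans (1+double%4 a) (cong (if_then 3 else 1) (sym (not-involutive (odd a))))))

double≢1+double-mod4 : ∀ a b → suc (a * 2) % 4 ≢ (b * 2) % 4
double≢1+double-mod4 a b p with odd a | odd b | trans (sym (1+double%4 a)) (trans p (double%4 b))
... | true  | true  | ()
... | true  | false | ()
... | false | true  | ()
... | false | false | ()

double-mod4⇒odd : ∀ a b → (a * 2) % 4 ≡ (b * 2) % 4 → odd a ≡ odd b
double-mod4⇒odd a b p with odd a | odd b | trans (sym (double%4 a)) (trans p (double%4 b))
... | true  | true  | _ = refl
... | false | false | _ = refl

module _ D {M : Matrix (suc D * 2)}
         (steinhaus : IsSteinhaus (suc D * 2) M) (multi : IsMultiSymmetric (suc D * 2) M) where

  private φ = tri D M
  open Symmetric (tri-symmetric D steinhaus multi)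
  open Vanishing (tri-symmetric D steinhaus multi) using (corner; centre)

  -- By S₃-invariance column z of M is the row of the triangle at level r = 2D + 1 − z.
  rows : ℕ → ℕ → ℕ
  rows z r = antidiag (λ x y → φ x y r) z + antidiag (λ x y → φ x y z) r

  degree-rows : ∀ i {z r} → toℕ i ≡ z → z + r ≡ suc (D * 2) → degree M i ≡ rows z r
  degree-rows i {z} {r} i≡ s≡ = begin
    degree M i                           ≡⟨ cong sum (map-tabulate id (bit ∘ M i)) ⟩
    sum (tabulate (bit ∘ M i))           ≡⟨ sum-tabulate (suc D * 2) f (bit ∘ M i) (λ j → cong bit (sym (extend-toℕ (M i) j refl))) ⟩
    antidiag (λ _ → f) (suc D * 2)           ≡⟨ cong (antidiag (λ _ → f)) (sym (trans (+-suc z r) (cong suc s≡))) ⟩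
    antidiag (λ _ → f) (z + suc r)           ≡⟨ antidiag-split z (suc r) (λ _ → f) ⟩
    antidiag (λ _ → f) z + (bit (f (z + 0)) + antidiag (λ _ y → f (z + suc y)) r)
      ≡⟨ cong₂ _+_ (antidiag-cong z below) (cong₂ _+_ (cong bit on) (antidiag-cong r beyond)) ⟩
    rows z r                             ∎
    where
    open ≡-Reasoning
    f = extend (M i)
    on : f (z + 0) ≡ false
    on = trans (extend-toℕ (M i) i (trans i≡ (sym (+-identityʳ z)))) (proj₁ steinhaus i)
    below : ∀ x y → suc (x + y) ≡ z → f y ≡ φ x y r
    below x y p = let (j , _ , j≡ , _) = position D r x y s in
      trans (extend-toℕ (M i) j j≡) (trans (proj₁ (proj₂ steinhaus) i j) (trans
        (sym (tri-entry D M s j≡ (trans i≡ (trans (sym p) (cong suc (+-comm x y))))))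
        (trans (swap₁₃ r x y) (swap₁₂ y x r))))
      where
      eq : ∀ r x y → suc (r + x + y) ≡ suc (x + y) + r
      eq = solve-∀
      s : r + x + y ≡ D * 2
      s = suc-injective (trans (eq r x y) (trans (cong (_+ r) p) s≡))
    beyond : ∀ x y → suc (x + y) ≡ r → f (z + suc y) ≡ φ x y z
    beyond x y p = let (_ , j , _ , j≡) = position D x y z s in
      trans (extend-toℕ (M i) j (trans j≡ (sym (+-suc z y)))) (sym (tri-entry D M s i≡ j≡))
      where
      eq : ∀ x y z → suc (x + y + z) ≡ z + suc (x + y)
      eq = solve-∀
      s : x + y + z ≡ D * 2
      s = suc-injective (trans (eq x y z) (trans (cong (z +_) p) s≡))

  -- The rule makes the half row telescope. A palindromic row counts twice its half, up to a middle
  -- entry, so these parities are what makes degrees modulo 4 linear in `φ`.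
  odd-half-row : ∀ c l w → odd (antidiag (λ x y → φ (c + x) y (suc w)) l) ≡ φ (c + l) 0 w xor φ c l w
  odd-half-row c l w = trans
    (odd-antidiag-telescope l _ (λ x y → φ (c + x) y w)
      (λ x y → trans (rule (c + x) y w) (cong (λ t → φ t y w xor φ (c + x) (suc y) w) (sym (+-suc c x)))))
    (cong (λ t → φ (c + l) 0 w xor φ t l w) (+-identityʳ c))

  module _ (regular : RegularMod4 M) where

    rows-const : ∀ z r z′ r′ → z + r ≡ suc (D * 2) → z′ + r′ ≡ suc (D * 2) → rows z r % 4 ≡ rows z′ r′ % 4
    rows-const z r z′ r′ p p′ = trans (cong (_% 4) (sym (degree-rows _ (toℕ-fromℕ< (vertex z r p)) p)))
      (trans (regular _ _) (cong (_% 4) (degree-rows _ (toℕ-fromℕ< (vertex z′ r′ p′)) p′)))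
      where
      vertex : ∀ z r → z + r ≡ suc (D * 2) → z < suc D * 2
      vertex z r p = s≤s (≤-trans (m≤m+n z r) (≤-reflexive p))

    even-row : ∀ u w → antidiag (λ x y → φ x y w) (u * 2) ≡ antidiag (λ x y → φ (u + x) y w) u * 2
    even-row u w = trans (cong (antidiag (λ x y → φ x y w)) (*2≡+ u))
      (antidiag-sym-even u (λ x y → φ x y w) λ x y → swap₁₂ x y w)

    odd-row : ∀ u w → antidiag (λ x y → φ x y w) (suc (u * 2)) ≡
                      bit (φ u u w) + antidiag (λ x y → φ (suc u + x) y w) u * 2
    odd-row u w = trans (cong (antidiag (λ x y → φ x y w) ∘ suc) (*2≡+ u))
      (antidiag-sym-odd u (λ x y → φ x y w) λ x y → swap₁₂ x y w)

    module _ (0<D : 0 < D) where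
      private
        A = antidiag (λ x y → φ (suc D + x) y 0) D
        B = antidiag (λ x y → φ (D + x) y 1) D

      vertex-zero : ∀ d → 0 < d → φ 0 0 d ≡ false
      vertex-zero (suc d) _ = corner d

      rows-1 : rows 1 (D * 2) ≡ B * 2
      rows-1 = cong₂ _+_ (trans (+-identityʳ _) (cong bit (vertex-zero (D * 2) (*-monoˡ-< 2 0<D)))) (even-row D 1)

      -- The first vertex has degree `bit (φ D D 0) + A * 2` and the second `B * 2`; already their
      -- parities decide.
      tri-middle : φ D D 0 ≡ false
      tri-middle with φ D D 0 in eq
      ... | false = refl
      ... | true  = contradiction
        (trans (cong (_% 4) (trans (cong (λ b → bit b + A * 2) (sym eq)) (sym (odd-row D 0))))
          (trans (rows-const 0 (suc (D * 2)) 1 (D * 2) refl refl) (cong (_% 4) rows-1)))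
        (double≢1+double-mod4 A B)

      -- The half row telescopes to a corner and the middle entry, both zero; the common degree is
      -- therefore 0 modulo 4.
      odd-B : odd B ≡ false
      odd-B = trans (odd-half-row D D 0) (cong₂ _xor_
        (trans (swap₁₃ (D + D) 0 0) (vertex-zero (D + D) (≤-trans 0<D (m≤m+n D D)))) tri-middle)

      -- With `u` and `v` as rebound below, the vertex of index 2v + 1 has degree 2(P + Q), so P + Q
      -- is even like `B`. Both half rows telescope, and `start` cancels the border entries that
      -- remain.
      tri-fold⁺ : ∀ u v → suc u + suc v ≡ D → φ (suc v * 2) 1 (suc (u * 2)) ≡ φ (suc (suc v)) (suc v) (suc (u * 2))
      tri-fold⁺ u′ v′ s≡ = xor-solve (φ (u * 2) 0 (v * 2)) (φ (suc (v * 2)) 0 w) _ _ start sums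
        where
        u = suc u′
        v = suc v′
        w = suc (u′ * 2)
        P = antidiag (λ x y → φ (suc v + x) y (u * 2)) v
        Q = antidiag (λ x y → φ (u + x) y (suc (v * 2))) u
        xor-solve : ∀ a b c d → a ≡ b xor c → (b xor d) xor a ≡ false → c ≡ d
        xor-solve a false c false refl p = p
        xor-solve a false c true  refl p = trans (sym (not-involutive c)) (cong not p)
        xor-solve a true  c false refl p = trans (sym (not-involutive c)) p
        xor-solve a true  c true  refl p = trans (sym (not-involutive c)) (cong not p)
        start : φ (u * 2) 0 (v * 2) ≡ φ (suc (v * 2)) 0 w xor φ (v * 2) 1 w
        start = trans (swap₁₃ (u * 2) 0 (v * 2)) (rule (v * 2) 0 w)
        odd-P : odd P ≡ φ (suc (v * 2)) 0 w xor φ (suc v) v w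
        odd-P = trans (odd-half-row (suc v) v w) (cong (λ t → φ (suc t) 0 w xor φ (suc v) v w) (sym (*2≡+ v)))
        odd-Q : odd Q ≡ φ (u * 2) 0 (v * 2)
        odd-Q = trans (odd-half-row u u (v * 2)) (trans
          (cong₂ _xor_ (cong (λ t → φ t 0 (v * 2)) (sym (*2≡+ u))) (centre u (suc (v′ * 2)))) (xor-identityʳ _))
        total : rows (suc (v * 2)) (u * 2) ≡ (P + Q) * 2
        total = trans (cong₂ _+_ (trans (odd-row v (u * 2)) (cong (λ b → bit b + P * 2) (centre v w)))
          (even-row u (suc (v * 2)))) (sym (*-distribʳ-+ 2 P Q))
        eq : ∀ u v → suc (v * 2) + u * 2 ≡ suc ((u + v) * 2)
        eq = solve-∀
        sums : ((φ (suc (v * 2)) 0 w xor φ (suc v) v w) xor φ (u * 2) 0 (v * 2)) ≡ false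
        sums = trans (sym (cong₂ _xor_ odd-P odd-Q)) (trans (sym (odd-+ P Q)) (trans
          (double-mod4⇒odd (P + Q) B (trans (cong (_% 4) (sym total))
            (trans (rows-const (suc (v * 2)) (u * 2) 1 (D * 2) (trans (eq u v) (cong (λ t → suc (t * 2)) s≡)) refl)
              (cong (_% 4) rows-1))))
          odd-B))

    tri-fold : ∀ u v → φ (v * 2) 1 (suc (u * 2)) ≡ φ (suc v) v (suc (u * 2))
    tri-fold u zero    = swap₁₂ 0 1 (suc (u * 2))
    tri-fold u (suc v) with suc u + suc v ≟ D
    ... | yes s≡ = tri-fold⁺ (subst (0 <_) s≡ (s≤s z≤n)) u v s≡
    ... | no  s≢ = trans (off (suc v * 2) 1 (suc (u * 2)) (λ p → s≢ (*-cancelʳ-≡ _ _ 2 (trans (eq₁ u v) p))))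
      (sym (off (suc (suc v)) (suc v) (suc (u * 2)) (λ p → s≢ (*-cancelʳ-≡ _ _ 2 (trans (eq₂ u v) p)))))
      where
      eq₁ : ∀ u v → (suc u + suc v) * 2 ≡ suc v * 2 + 1 + suc (u * 2)
      eq₁ = solve-∀
      eq₂ : ∀ u v → (suc u + suc v) * 2 ≡ suc (suc v) + suc v + suc (u * 2)
      eq₂ = solve-∀

    tri-regular : Regular D φ
    tri-regular = record { symmetric = tri-symmetric D steinhaus multi ; middle = tri-middle ; fold = tri-fold }

-- Linearity and the determining entries.

xor-interchange : ∀ a b c d → (a xor b) xor (c xor d) ≡ (a xor c) xor (b xor d)
xor-interchange a b c d = trans (xor-assoc a b (c xor d)) (trans
  (cong (a xor_) (trans (sym (xor-assoc b c d)) (trans (cong (_xor d) (xor-comm b c)) (xor-assoc c b d))))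
  (sym (xor-assoc a c (b xor d))))

difference : ∀ {D φ ψ} → Regular D φ → Regular D ψ → Regular D (λ x y z → φ x y z xor ψ x y z)
difference {φ = φ} {ψ} R S = record
  { symmetric = record
    { off    = λ x y z s≢ → cong₂ _xor_ (R.off x y z s≢) (S.off x y z s≢)
    ; rule   = λ x y z → trans (cong₂ _xor_ (R.rule x y z) (S.rule x y z))
                 (xor-interchange (φ (suc x) y z) (φ x (suc y) z) (ψ (suc x) y z) (ψ x (suc y) z))
    ; swap₁₂ = λ x y z → cong₂ _xor_ (R.swap₁₂ x y z) (S.swap₁₂ x y z)
    ; swap₁₃ = λ x y z → cong₂ _xor_ (R.swap₁₃ x y z) (S.swap₁₃ x y z)
    }
  ; middle = λ 0<D → cong₂ _xor_ (R.middle 0<D) (S.middle 0<D)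
  ; fold   = λ u v → cong₂ _xor_ (R.fold u v) (S.fold u v)
  }
  where
  module R = Regular R
  module S = Regular S

-- The entry next to the median in row 2(f + t) + 1; truncation occurs only for f + t ≥ D, where the value is junk.
key : ∀ D f → (ℕ → ℕ → ℕ → Bool) → ℕ → Bool
key D f φ t = φ (D ∸ (f + t)) (D ∸ suc (f + t)) (suc ((f + t) * 2))

module _ {D} f K L (1+4f≤D : 1 + f * 4 ≤ D) (3K≤ : K * 3 ≤ 2 + D * 2) (D≤ : D ≤ f + L + K) where

  -- On the plane the row is 2w + 1 with k + 1 + w = D, so `D≤` turns `K ≤ k` into `w < f + L`: each
  -- entry needed by `vanishing` is a key or lies off the plane.
  key-zero⇒zero : ∀ {φ} → Regular D φ → (∀ t → t < L → key D f φ t ≡ false) → ∀ x y z → φ x y z ≡ false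
  key-zero⇒zero {φ} R p = vanishing {f} 1+4f≤D 3K≤ medians
    where
    open RegularVanishing R
    open Regular R using (off)
    medians : ∀ e k → f * 2 ≤ e → K ≤ k → φ (suc k) k (suc e) ≡ false
    medians e k 2f≤e K≤k with suc k + k + suc e ≟ D * 2 | halve e
    ... | no s≢  | _ = off (suc k) k (suc e) s≢
    ... | yes s≡ | w , inj₂ refl = contradiction s≡ (1+k+k+even≢even k w D)
    ... | yes s≡ | w , inj₁ refl = subst₂ (λ a b → φ a b (suc (w * 2)) ≡ false) D∸w≡ D∸1+w≡
      (subst (λ t → φ (D ∸ t) (D ∸ suc t) (suc (t * 2)) ≡ false) (m+[n∸m]≡n f≤w) (p (w ∸ f) w∸f<L))
      where
      f≤w : f ≤ w
      f≤w = *-cancelʳ-≤ f w 2 2f≤e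
      eq : ∀ k w → suc k + k + suc (w * 2) ≡ (suc k + w) * 2
      eq = solve-∀
      1+k+w≡D : suc k + w ≡ D
      1+k+w≡D = *-cancelʳ-≡ (suc k + w) D 2 (trans (sym (eq k w)) s≡)
      D∸w≡ : D ∸ w ≡ suc k
      D∸w≡ = trans (cong (_∸ w) (sym 1+k+w≡D)) (m+n∸n≡m (suc k) w)
      D∸1+w≡ : D ∸ suc w ≡ k
      D∸1+w≡ = trans (cong (_∸ suc w) (trans (sym 1+k+w≡D) (sym (+-suc k w)))) (m+n∸n≡m k (suc w))
      w<f+L : w < f + L
      w<f+L = +-cancelˡ-≤ k (suc w) (f + L) (begin
        k + suc w    ≡⟨ trans (+-suc k w) 1+k+w≡D ⟩
        D            ≤⟨ D≤ ⟩
        f + L + K    ≤⟨ +-monoʳ-≤ (f + L) K≤k ⟩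
        f + L + k    ≡⟨ +-comm (f + L) k ⟩
        k + (f + L)  ∎)
        where open ≤-Reasoning
      w∸f<L : w ∸ f < L
      w∸f<L = +-cancelˡ-< f (w ∸ f) L (subst (_< f + L) (sym (m+[n∸m]≡n f≤w)) w<f+L)

-- Counting the matrices.

Admissible : ∀ n → Matrix n → Set
Admissible n M = IsSteinhaus n M × IsMultiSymmetric n M × RegularMod4 M

tri-injective-upper : ∀ D {A B : Matrix (suc D * 2)} → (∀ x y z → tri D A x y z ≡ tri D B x y z) →
        ∀ i j → toℕ i < toℕ j → A i j ≡ B i j
tri-injective-upper D {A} {B} p i j i<j = trans (sym (tri-entry D A s≡ refl j≡)) (trans (p x y z) (tri-entry D B s≡ refl j≡))
  where
  z = toℕ i
  y = toℕ j ∸ suc z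
  x = D * 2 ∸ (z + y)
  j≡ : toℕ j ≡ suc (z + y)
  j≡ = sym (m+[n∸m]≡n i<j)
  z+y≤ : z + y ≤ D * 2
  z+y≤ = ≤-pred (≤-pred (subst (_< suc D * 2) j≡ (toℕ<n j)))
  s≡ : x + y + z ≡ D * 2
  s≡ = trans (trans (+-assoc x y z) (cong (x +_) (+-comm y z))) (m∸n+n≡m z+y≤)

tri-injective : ∀ D {A B : Matrix (suc D * 2)} → IsSteinhaus (suc D * 2) A → IsSteinhaus (suc D * 2) B →
                (∀ x y z → tri D A x y z ≡ tri D B x y z) → ∀ i j → A i j ≡ B i j
tri-injective D {A} {B} (A₀ , Aₛ , _) (B₀ , Bₛ , _) p i j with <-cmp (toℕ i) (toℕ j)
... | tri< i<j _ _ = tri-injective-upper D p i j i<j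
... | tri> _ _ j<i = trans (Aₛ i j) (trans (tri-injective-upper D p j i j<i) (Bₛ j i))
... | tri≈ _ i≡j _ with toℕ-injective i≡j
...   | refl = trans (A₀ i) (sym (B₀ i))

toFin₂ : Bool → Fin 2
toFin₂ false = Fin.zero
toFin₂ true  = Fin.suc Fin.zero

toFin₂-injective : ∀ a b → toFin₂ a ≡ toFin₂ b → a ≡ b
toFin₂-injective false false _ = refl
toFin₂-injective true  true  _ = refl

-- Pigeonhole: beyond 2 ^ L indices, two L-bit codes coincide.
code-bound : ∀ {X : Set} {m L} (F : Fin m → X) (c : X → Fin L → Bool) →
             (∀ a b → (∀ t → c (F a) t ≡ c (F b) t) → a ≡ b) → m ≤ 2 ^ L
code-bound {m = m} {L} F c inj with m ≤? 2 ^ L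
... | yes m≤ = m≤
... | no m≰ with pigeonhole (≰⇒> m≰) (λ a → funToFin (toFin₂ ∘ c (F a)))
...   | a , b , a<b , e = contradiction (cong toℕ (inj a b λ t → toFin₂-injective _ _ (trans
        (sym (finToFun-funToFin (toFin₂ ∘ c (F a)) t)) (trans (cong (λ u → finToFun u t) e)
          (finToFun-funToFin (toFin₂ ∘ c (F b)) t))))) (<⇒≢ a<b)

<⌈⌉ : ∀ a b → a < suc b + (a / suc b) * suc b
<⌈⌉ a b = ≤-trans (≤-reflexive (cong suc (m≡m%n+[m/n]*n a (suc b)))) (+-monoˡ-≤ _ (m%n<n a (suc b)))

-- f = ⌊(n − 4)/8⌋ makes 2f + 1 the largest odd number ≤ n/4, and K = ⌊n/3⌋.
window : ∀ D → 0 < D → ∃[ f ] ∃[ K ] (1 + f * 4 ≤ D × K * 3 ≤ 2 + D * 2 × D ≤ f + ceil24 (suc D * 2) + K)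
window (suc D) _ = f , K , s≤s (m/n*n≤m D 4) , m/n*n≤m n 3 ,
  *-cancelˡ-< 24 D (f + L + K) (+-cancelˡ-≤ 72 (1 + 24 * D) (24 * (f + L + K)) (begin
    72 + (1 + 24 * D)                                           ≤⟨ n≤1+n _ ⟩
    suc (72 + (1 + 24 * D))                                     ≡⟨ eq₁ D ⟩
    -- Rounding down loses less than the divisors 4, 24 and 3; the weights 6, 1 and 8 bring them all
    -- to 24.
    suc D * 6 + suc (n + 23) + suc n * 8                        ≤⟨ +-mono-≤ (+-mono-≤
      (*-monoˡ-≤ 6 (<⌈⌉ D 3)) (<⌈⌉ (n + 23) 23)) (*-monoˡ-≤ 8 (<⌈⌉ n 2)) ⟩
    (4 + f * 4) * 6 + (24 + L * 24) + (3 + K * 3) * 8           ≡⟨ eq₂ f L K ⟩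
    72 + 24 * (f + L + K)                                       ∎))
  where
  open ≤-Reasoning
  n = suc (suc D) * 2
  f = D / 4
  K = n / 3
  L = ceil24 n
  eq₁ : ∀ D → suc (72 + (1 + 24 * D)) ≡ suc D * 6 + suc (suc (suc D) * 2 + 23) + suc (suc (suc D) * 2) * 8
  eq₁ = solve-∀
  eq₂ : ∀ f L K → (4 + f * 4) * 6 + (24 + L * 24) + (3 + K * 3) * 8 ≡ 72 + 24 * (f + L + K)
  eq₂ = solve-∀

bound : ∀ D L {m} (F : Fin m → Matrix (suc D * 2)) → (∀ a → Admissible (suc D * 2) (F a)) →
        (∀ a b → ¬ a ≡ b → ∃[ i ] ∃[ j ] ¬ F a i j ≡ F b i j) →
        (c : (ℕ → ℕ → ℕ → Bool) → ℕ → Bool) →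
        (∀ {φ ψ} → Regular D φ → Regular D ψ → (∀ t → t < L → c φ t ≡ c ψ t) → ∀ x y z → φ x y z ≡ ψ x y z) →
        m ≤ 2 ^ L
bound D L F adm distinct c determines = code-bound F (λ M t → c (tri D M) (toℕ t)) λ a b p →
  decidable-stable (a Fin.≟ b) λ a≢b → let (i , j , q) = distinct a b a≢b in
    q (tri-injective D (proj₁ (adm a)) (proj₁ (adm b))
      (determines (regular a) (regular b) λ t t<L →
        subst (λ s → c (tri D (F a)) s ≡ c (tri D (F b)) s) (toℕ-fromℕ< t<L) (p (fromℕ< t<L))) i j)
  where
  regular : ∀ a → Regular D (tri D (F a))
  regular a = let (s , m , r) = adm a in tri-regular D s m r

theorem7 : (n : ℕ) → 0 < n → 2 ∣ n →
    (m : ℕ) (F : Fin m → Matrix n) →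
    (∀ a → IsSteinhaus n (F a) × IsMultiSymmetric n (F a) × RegularMod4 (F a)) →
    (∀ a b → ¬ a ≡ b → ∃[ i ] ∃[ j ] ¬ F a i j ≡ F b i j) →
    m ≤ 2 ^ ceil24 n
theorem7 _ () (divides zero refl)
-- For `D = 0` no `f` satisfies `1 + f * 4 ≤ D`. The plane is then one point, and `ceil24 2 = 1` bit
-- records its value.
theorem7 _ _ (divides (suc zero) refl) m F adm distinct = bound 0 1 F adm distinct (λ φ _ → φ 0 0 0)
  λ { {φ} {ψ} R S p → λ where
        zero zero zero → p 0 (s≤s z≤n)
        (suc x) y z → trans (Regular.off R (suc x) y z λ ()) (sym (Regular.off S (suc x) y z λ ()))
        zero (suc y) z → trans (Regular.off R zero (suc y) z λ ()) (sym (Regular.off S zero (suc y) z λ ()))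
        zero zero (suc z) → trans (Regular.off R zero zero (suc z) λ ()) (sym (Regular.off S zero zero (suc z) λ ())) }
theorem7 _ _ (divides (suc D@(suc _)) refl) m F adm distinct =
  let (f , K , 1+4f≤D , 3K≤ , D≤) = window D (s≤s z≤n) in
  bound D (ceil24 (suc D * 2)) F adm distinct (key D f) λ {φ} {ψ} R S p x y z →
    xor-≡false⇒≡ (φ x y z) (ψ x y z) (key-zero⇒zero f K (ceil24 (suc D * 2)) 1+4f≤D 3K≤ D≤ (difference R S)
      (λ t t<L → trans (cong (_xor key D f ψ t) (p t t<L)) (xor-same (key D f ψ t))) x y z)
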